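{- Let $f:\{0,1\}^n\to\{0,1\}$ be a non-constant Boolean function. Then $$\mathrm{RC}(f)\le 2\,\mathrm{UC}_{\min}(f)-1.$$
   Context: For $x\in\{0,1\}^n$ and $B\subseteq[n]$, $x^B$ is $x$ with the bits in $B$ flipped; $B$ is a sensitive block of $x$ if $f(x^B)\ne f(x)$. $\mathrm{RC}_x(f)$ (randomized certificate complexity, i.e. fractional block sensitivity) is the maximum of $\sum_B a_B$ over non-negative real weights $a_B$ on the sensitive blocks $B$ of $x$ such that $\sum_{B\ni i}a_B\le1$ for every $i\in[n]$. Equivalently, by LP duality, it is the minimum of $\sum_{i\in [n]}c_i$ over non-negative weights $c_i$ with $\sum_{i\in B}c_i\ge1$ for every sensitive block $B$ of $x$. $\mathrm{RC}(f)=\max_x\mathrm{RC}_x(f)$. Partial assignments are strings $p\in\{0,1,*\}^n$; $|p|$ is the number of non-$*$ entries; $p\subseteq x$ means $x$ agrees with $p$ on all non-$*$ entries; two partial assignments are consistent if they agree wherever neither has $*$. $p$ is a $b$-certificate if $f(x)=b$ for all $x\supseteq p$. An unambiguous collection of $b$-certificates for $f$ is a set $U$ of $b$-certificates such that every $x\in f^{ -1}(b)$ satisfies $p\subseteq x$ for some $p\in U$, and no two distinct elements of $U$ are consistent. $\mathrm{UC}_b(f)$ is the minimum of $\max_{p\in U}|p|$ over such $U$, and $\mathrm{UC}_{\min}(f)=\min\{\mathrm{UC}_0(f),\mathrm{UC}_1(f)\}$. -}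

module Defs where

open import Algebra.Bundles using (CommutativeRing)
import Algebra.Properties.CommutativeSemigroup as CommutativeSemigroupProperties
open import Data.Bool using (Bool; true; false; _xor_)
import Data.Bool.Properties as Bool
open import Data.Fin.Subset using (Subset; inside; outside)
open import Data.Fin.Subset.Properties using (_∈?_)
open import Data.Integer using (ℤ; +_)
open import Data.List using (List; []; _∷_; _++_; map; filter; foldr)
open import Data.List.Extrema.Nat using (max)
import Data.List.Membership.Propositional as List
open import Data.Maybe using (Maybe; just; is-just)
open import Data.Nat as ℕ using (ℕ; zero; suc; _⊓_)
open import Data.Product using (∃; ∃₂; _×_)
open import Data.Rational as ℚ using (ℚ; 0ℚ; 1ℚ; ½)
import Data.Rational.Properties as ℚ
open import Data.Vec using (Vec; []; _∷_; lookup; zipWith; countᵇ)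
open import Level using (Level; _⊔_)
open import Relation.Binary.Core using (Rel)
open import Relation.Binary.PropositionalEquality using (_≡_; _≢_; cong; cong₂; subst; sym; trans)
open import Relation.Nullary using (¬_)
open import Relation.Nullary.Decidable using (¬?)
open import Relation.Unary using (Pred; Decidable)

private
  variable
    n : ℕ

module _ {a ℓ p : Level} {A : Set a} (_≤_ : Rel A ℓ) (P : Pred A p) where

  IsMaximum : Pred A (a ⊔ ℓ ⊔ p)
  IsMaximum m = P m × (∀ s → P s → s ≤ m)

  IsMinimum : Pred A (a ⊔ ℓ ⊔ p)
  IsMinimum m = P m × (∀ s → P s → m ≤ s)

½^ : ℕ → ℚ
½^ zero    = 1ℚ
½^ (suc k) = ½ ℚ.* ½^ k

-- Real numbers as rational Cauchy sequences with a fixed modulus: the k-th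
-- term is within ½^ k of the limit. Equality of reals is _≈ℝ_, not _≡_.
record ℝ : Set where
  constructor mkℝ
  field
    approx  : ℕ → ℚ
    regular : ∀ j k → ℚ.∣ approx j ℚ.- approx k ∣ ℚ.≤ ½^ j ℚ.+ ½^ k

open ℝ public

infix  4 _≤ℝ_ _≈ℝ_
infixl 6 _+ℝ_

_≤ℝ_ : Rel ℝ _
x ≤ℝ y = ∀ k → approx x k ℚ.≤ approx y k ℚ.+ (½^ k ℚ.+ ½^ k)

_≈ℝ_ : Rel ℝ _
x ≈ℝ y = (x ≤ℝ y) × (y ≤ℝ x)

private
  0≤½^ : ∀ k → 0ℚ ℚ.≤ ½^ k
  0≤½^ zero    = ℚ.nonNegative⁻¹ 1ℚ
  0≤½^ (suc k) = subst (ℚ._≤ ½ ℚ.* ½^ k) (ℚ.*-zeroʳ ½) (ℚ.*-monoˡ-≤-nonNeg ½ (0≤½^ k))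

  half+half : ∀ q → ½ ℚ.* q ℚ.+ ½ ℚ.* q ≡ q
  half+half q = trans (sym (ℚ.*-distribʳ-+ q ½ ½)) (ℚ.*-identityˡ q)

  open CommutativeSemigroupProperties
    (CommutativeRing.+-commutativeSemigroup ℚ.+-*-commutativeRing) using (interchange)

fromℚ : ℚ → ℝ
fromℚ q = mkℝ (λ _ → q) λ j k → begin
  ℚ.∣ q ℚ.- q ∣      ≡⟨ cong ℚ.∣_∣ (ℚ.+-inverseʳ q) ⟩
  0ℚ                 ≤⟨ ℚ.+-mono-≤ (0≤½^ j) (0≤½^ k) ⟩
  ½^ j ℚ.+ ½^ k      ∎
  where open ℚ.≤-Reasoning

fromℤ : ℤ → ℝ
fromℤ z = fromℚ (z ℚ./ 1)

0ℝ 1ℝ : ℝ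
0ℝ = fromℚ 0ℚ
1ℝ = fromℚ 1ℚ

_+ℝ_ : ℝ → ℝ → ℝ
x +ℝ y = mkℝ (λ k → approx x (suc k) ℚ.+ approx y (suc k)) λ j k →
  let x₁ = approx x (suc j) ; x₂ = approx x (suc k)
      y₁ = approx y (suc j) ; y₂ = approx y (suc k)
  in begin
  ℚ.∣ (x₁ ℚ.+ y₁) ℚ.- (x₂ ℚ.+ y₂) ∣
    ≡⟨ cong ℚ.∣_∣ (cong ((x₁ ℚ.+ y₁) ℚ.+_) (ℚ.neg-distrib-+ x₂ y₂)) ⟩
  ℚ.∣ (x₁ ℚ.+ y₁) ℚ.+ (ℚ.- x₂ ℚ.- y₂) ∣
    ≡⟨ cong ℚ.∣_∣ (interchange x₁ y₁ (ℚ.- x₂) (ℚ.- y₂)) ⟩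
  ℚ.∣ (x₁ ℚ.- x₂) ℚ.+ (y₁ ℚ.- y₂) ∣
    ≤⟨ ℚ.∣p+q∣≤∣p∣+∣q∣ (x₁ ℚ.- x₂) (y₁ ℚ.- y₂) ⟩
  ℚ.∣ x₁ ℚ.- x₂ ∣ ℚ.+ ℚ.∣ y₁ ℚ.- y₂ ∣
    ≤⟨ ℚ.+-mono-≤ (regular x (suc j) (suc k)) (regular y (suc j) (suc k)) ⟩
  (½^ (suc j) ℚ.+ ½^ (suc k)) ℚ.+ (½^ (suc j) ℚ.+ ½^ (suc k))
    ≡⟨ interchange (½^ (suc j)) (½^ (suc k)) (½^ (suc j)) (½^ (suc k)) ⟩
  (½^ (suc j) ℚ.+ ½^ (suc j)) ℚ.+ (½^ (suc k) ℚ.+ ½^ (suc k))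
    ≡⟨ cong₂ ℚ._+_ (half+half (½^ j)) (half+half (½^ k)) ⟩
  ½^ j ℚ.+ ½^ k ∎
  where open ℚ.≤-Reasoning

sumℝ : List ℝ → ℝ
sumℝ = foldr _+ℝ_ 0ℝ

Input : ℕ → Set
Input n = Vec Bool n

BoolFun : ℕ → Set
BoolFun n = Input n → Bool

NonConstant : BoolFun n → Set
NonConstant f = ∃₂ λ x y → f x ≢ f y

flipBlock : Input n → Subset n → Input n
flipBlock = zipWith _xor_

allSubsets : ∀ n → List (Subset n)
allSubsets zero    = [] ∷ []
allSubsets (suc n) = map (inside ∷_) (allSubsets n) ++ map (outside ∷_) (allSubsets n)

module _ (f : BoolFun n) (x : Input n) where

  Sensitive : Pred (Subset n) _
  Sensitive B = f (flipBlock x B) ≢ f x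

  sensitive? : Decidable Sensitive
  sensitive? B = ¬? (f (flipBlock x B) Bool.≟ f x)

  sensitiveBlocks : List (Subset n)
  sensitiveBlocks = filter sensitive? (allSubsets n)

  -- Only the values of a weighting at sensitive blocks matter, here and in
  -- totalWeight.
  record IsFractionalPacking (a : Subset n → ℝ) : Set where
    field
      nonNegative : ∀ B → Sensitive B → 0ℝ ≤ℝ a B
      load≤1      : ∀ i → sumℝ (map a (filter (i ∈?_) sensitiveBlocks)) ≤ℝ 1ℝ

  totalWeight : (Subset n → ℝ) → ℝ
  totalWeight a = sumℝ (map a sensitiveBlocks)

  -- The real number r is RC_x(f).
  IsRCAt : Pred ℝ _
  IsRCAt = IsMaximum _≤ℝ_ (λ r → ∃ λ a → IsFractionalPacking a × r ≈ℝ totalWeight a)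

IsRC : BoolFun n → Pred ℝ _
IsRC f = IsMaximum _≤ℝ_ (λ r → ∃ λ x → IsRCAt f x r)

-- Partial assignments, with nothing in the role of *.
Partial : ℕ → Set
Partial n = Vec (Maybe Bool) n

size : Partial n → ℕ
size = countᵇ is-just

infix 4 _⊑_

_⊑_ : Partial n → Input n → Set
p ⊑ x = ∀ i b → lookup p i ≡ just b → lookup x i ≡ b

Consistent : Rel (Partial n) _
Consistent p q = ∀ i b c → lookup p i ≡ just b → lookup q i ≡ just c → b ≡ c

module _ (f : BoolFun n) (b : Bool) where

  IsCertificate : Pred (Partial n) _
  IsCertificate p = ∀ x → p ⊑ x → f x ≡ b

  -- Finite sets of partial assignments are lists; repetitions are harmless,
  -- since only distinct members are required to be inconsistent.
  record IsUnambiguousCollection (U : List (Partial n)) : Set where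
    field
      certificates : ∀ p → p List.∈ U → IsCertificate p
      covers       : ∀ x → f x ≡ b → ∃ λ p → p List.∈ U × p ⊑ x
      unambiguous  : ∀ p q → p List.∈ U → q List.∈ U → p ≢ q → ¬ Consistent p q

width : List (Partial n) → ℕ
width U = max 0 (map size U)

-- The natural number k is UC_b(f).
IsUC : BoolFun n → Bool → Pred ℕ _
IsUC f b = IsMinimum ℕ._≤_ (λ k → ∃ λ U → IsUnambiguousCollection f b U × k ≡ width U)

IsUCmin : BoolFun n → Pred ℕ _
IsUCmin f k = ∃₂ λ k₀ k₁ → IsUC f false k₀ × IsUC f true k₁ × k ≡ k₀ ⊓ k₁

{-# OPTIONS --safe #-}
-- Let U be an unambiguous collection of b-certificates of size at most k and
-- a a fractional packing of the sensitive blocks of x, of total weight W. If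
-- f x = b, the certificate of x meets every sensitive block, so W ≤ k.
-- Otherwise let p_B ∈ U be the certificate of x^B: it disagrees with x on a
-- nonempty subset of B and agrees with x on at most k − 1 indices. If p_B ≠ p_C,
-- they clash at an index where one of them agrees with x; the other disagrees
-- with x there, so its block contains that index. If p_B = p_C, both blocks
-- contain every disagreement. Summing a_B a_C over all pairs and bounding the
-- load of each index by 1 gives W² ≤ (1 + 2 (k − 1)) W.
--
-- The double count is carried out over ℚ, with a packing whose loads are bounded
-- by 1 + ε; real weights are approximated by such packings, with ε → 0.
module Submission where

open import Defs
open import Algebra.Bundles using (CommutativeRing)
import Algebra.Properties.CommutativeMonoid.Mult as Multiples
import Algebra.Properties.CommutativeSemigroup as CommutativeSemigroupProperties
open import Data.Bool using (Bool; true; false; _xor_; if_then_else_)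
import Data.Bool.Properties as Bool
open import Data.Fin using (Fin; zero; suc)
open import Data.Fin.Subset using (Subset; _∈_)
open import Data.Fin.Subset.Properties using (_∈?_)
open import Data.Integer as ℤ using (+_; 1ℤ; _*_; _-_)
import Data.Integer.Properties as ℤ
open import Data.List using (List; []; _∷_; map; filter; length)
open import Data.List.Extrema.Nat using (xs≤max)
import Data.List.Membership.Propositional as List
open import Data.List.Membership.Propositional.Properties using (∈-map⁺; ∈-map⁻; ∈-filter⁺)
import Data.List.Properties as List
open import Data.List.Relation.Unary.All as All using (All; []; _∷_)
open import Data.List.Relation.Unary.All.Properties using (all-filter; ¬All⇒Any¬)
open import Data.List.Relation.Unary.Any as Any using (Any; here; there)
open import Data.Maybe using (Maybe; just; nothing)
import Data.Maybe.Properties as Maybe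
open import Data.Nat as ℕ using (ℕ; zero; suc)
import Data.Nat.Coprimality as Coprimality
import Data.Nat.Properties as ℕ
open import Data.Product using (∃; ∃₂; _×_; _,_; proj₁; proj₂)
open import Data.Rational as ℚ using (ℚ; 0ℚ; 1ℚ; ½)
import Data.Rational.Properties as ℚ
open import Data.Rational.Solver using (module +-*-Solver)
open import Data.Sum as Sum using (_⊎_; inj₁; inj₂; [_,_]′)
open import Data.Vec using ([]; _∷_; lookup)
import Data.Vec.Properties as Vec
open import Function using (_∘_)
open import Relation.Binary.PropositionalEquality
  using (_≡_; _≢_; refl; sym; trans; cong; cong₂; subst; module ≡-Reasoning)
open import Relation.Nullary using (Dec; yes; no; does; ¬_; contradiction)
open import Relation.Unary using (Pred; Decidable)

open Multiples (CommutativeRing.+-commutativeMonoid ℚ.+-*-commutativeRing)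
  renaming (_×_ to _·_)
open CommutativeSemigroupProperties
  (CommutativeRing.+-commutativeSemigroup ℚ.+-*-commutativeRing) using (interchange)
open +-*-Solver using (solve; _:=_; _:+_; _:*_; _:-_; :-_)

private
  variable
    n : ℕ
    A I J : Set

-- Rational inequalities, integer multiples and dyadic powers.

p≤q+∣p-q∣ : ∀ p q → p ℚ.≤ q ℚ.+ ℚ.∣ p ℚ.- q ∣
p≤q+∣p-q∣ p q = begin
  p                        ≡⟨ solve 2 (λ p q → p := q :+ (p :- q)) refl p q ⟩
  q ℚ.+ (p ℚ.- q)          ≤⟨ ℚ.+-monoʳ-≤ q (p≤∣p∣ (p ℚ.- q)) ⟩
  q ℚ.+ ℚ.∣ p ℚ.- q ∣      ∎
  where
  open ℚ.≤-Reasoning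
  p≤∣p∣ : ∀ p → p ℚ.≤ ℚ.∣ p ∣
  p≤∣p∣ p with ℚ.≤-total 0ℚ p
  ... | inj₁ 0≤p = ℚ.≤-reflexive (sym (ℚ.0≤p⇒∣p∣≡p 0≤p))
  ... | inj₂ p≤0 = ℚ.≤-trans p≤0 (ℚ.0≤∣p∣ p)

∣p-q∣≤r⇒p≤q+r : ∀ {p q r} → ℚ.∣ p ℚ.- q ∣ ℚ.≤ r → p ℚ.≤ q ℚ.+ r
∣p-q∣≤r⇒p≤q+r {p} {q} d = ℚ.≤-trans (p≤q+∣p-q∣ p q) (ℚ.+-monoʳ-≤ q d)

∣p-q∣≡∣q-p∣ : ∀ p q → ℚ.∣ p ℚ.- q ∣ ≡ ℚ.∣ q ℚ.- p ∣
∣p-q∣≡∣q-p∣ p q = trans (sym (ℚ.∣-p∣≡∣p∣ (p ℚ.- q)))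
  (cong ℚ.∣_∣ (solve 2 (λ p q → :- (p :- q) := q :- p) refl p q))

*-mono-≤-nonNegˡ : ∀ {p q r} → 0ℚ ℚ.≤ r → p ℚ.≤ q → r ℚ.* p ℚ.≤ r ℚ.* q
*-mono-≤-nonNegˡ {r = r} 0≤r = ℚ.*-monoˡ-≤-nonNeg r {{ℚ.nonNegative 0≤r}}

*-nonNeg : ∀ {p q} → 0ℚ ℚ.≤ p → 0ℚ ℚ.≤ q → 0ℚ ℚ.≤ p ℚ.* q
*-nonNeg {p} {q} 0≤p 0≤q =
  subst (ℚ._≤ p ℚ.* q) (ℚ.*-zeroʳ p) (*-mono-≤-nonNegˡ 0≤p 0≤q)

p≤p+q : ∀ {q} p → 0ℚ ℚ.≤ q → p ℚ.≤ p ℚ.+ q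
p≤p+q {q} p 0≤q = subst (ℚ._≤ p ℚ.+ q) (ℚ.+-identityʳ p) (ℚ.+-monoʳ-≤ p 0≤q)

·-nonNeg : ∀ k {q} → 0ℚ ℚ.≤ q → 0ℚ ℚ.≤ k · q
·-nonNeg zero    0≤q = ℚ.≤-refl
·-nonNeg (suc k) 0≤q = ℚ.+-mono-≤ 0≤q (·-nonNeg k 0≤q)

·-monoˡ-≤ : ∀ {q j k} → 0ℚ ℚ.≤ q → j ℕ.≤ k → j · q ℚ.≤ k · q
·-monoˡ-≤ {k = k} 0≤q ℕ.z≤n = ·-nonNeg k 0≤q
·-monoˡ-≤ {q} 0≤q (ℕ.s≤s j≤k) = ℚ.+-monoʳ-≤ q (·-monoˡ-≤ 0≤q j≤k)

n·1≡n/1 : ∀ n → n · 1ℚ ≡ + n ℚ./ 1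
n·1≡n/1 zero    = refl
n·1≡n/1 (suc n) = begin
  -- For a variable `n`, `+ n ℚ./ 1` is stuck on a gcd; the explicit fraction lets the addition
  -- compute.
  1ℚ ℚ.+ n · 1ℚ             ≡⟨ cong (1ℚ ℚ.+_) (trans (n·1≡n/1 n) (ℚ.normalize-coprime n⊥1)) ⟩
  1ℚ ℚ.+ ℚ.mkℚ (+ n) 0 n⊥1  ≡⟨ cong (λ i → (1ℤ ℤ.+ i) ℚ./ 1) (ℤ.*-identityʳ (+ n)) ⟩
  + suc n ℚ./ 1             ∎
  where
  open ≡-Reasoning
  n⊥1 = Coprimality.sym (Coprimality.1-coprimeTo n)

0≤½^ : ∀ k → 0ℚ ℚ.≤ ½^ k
0≤½^ zero    = ℚ.nonNegative⁻¹ 1ℚ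
0≤½^ (suc k) = *-nonNeg (ℚ.nonNegative⁻¹ ½) (0≤½^ k)

½^suc+½^suc≡½^ : ∀ k → ½^ (suc k) ℚ.+ ½^ (suc k) ≡ ½^ k
½^suc+½^suc≡½^ k = trans (sym (ℚ.*-distribʳ-+ (½^ k) ½ ½)) (ℚ.*-identityˡ (½^ k))

½^suc≤½^ : ∀ k → ½^ (suc k) ℚ.≤ ½^ k
½^suc≤½^ k = subst (½^ (suc k) ℚ.≤_) (½^suc+½^suc≡½^ k) (p≤p+q (½^ (suc k)) (0≤½^ (suc k)))

-- Each increment of `c` at most doubles the multiplier, and the extra halving pays for that.
suc·½^≤½^ : ∀ c j → suc c · ½^ (c ℕ.+ j) ℚ.≤ ½^ j
suc·½^≤½^ zero    j = ℚ.≤-reflexive (×-homo-1 (½^ j))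
suc·½^≤½^ (suc c) j = begin
  suc (suc c) · h           ≤⟨ ·-monoˡ-≤ (0≤½^ (suc c ℕ.+ j)) (ℕ.s≤s (ℕ.m≤n+m (suc c) c)) ⟩
  (suc c ℕ.+ suc c) · h     ≡⟨ ×-homo-+ h (suc c) (suc c) ⟩
  suc c · h ℚ.+ suc c · h   ≡⟨ ×-distrib-+ h h (suc c) ⟨
  suc c · (h ℚ.+ h)         ≡⟨ cong (suc c ·_) (½^suc+½^suc≡½^ (c ℕ.+ j)) ⟩
  suc c · ½^ (c ℕ.+ j)      ≤⟨ suc·½^≤½^ c j ⟩
  ½^ j                      ∎
  where
  open ℚ.≤-Reasoning
  h = ½^ (suc c ℕ.+ j)

-- Finite rational sums and indicators.

∑ : List A → (A → ℚ) → ℚ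
∑ []       g = 0ℚ
∑ (x ∷ xs) g = g x ℚ.+ ∑ xs g

∑-mono-≤ : ∀ (xs : List A) {g h} → (∀ x → g x ℚ.≤ h x) → ∑ xs g ℚ.≤ ∑ xs h
∑-mono-≤ []       g≤h = ℚ.≤-refl
∑-mono-≤ (x ∷ xs) g≤h = ℚ.+-mono-≤ (g≤h x) (∑-mono-≤ xs g≤h)

∑-cong : ∀ (xs : List A) {g h} → (∀ x → g x ≡ h x) → ∑ xs g ≡ ∑ xs h
∑-cong []       g≡h = refl
∑-cong (x ∷ xs) g≡h = cong₂ ℚ._+_ (g≡h x) (∑-cong xs g≡h)

∑-const : ∀ (xs : List A) q → ∑ xs (λ _ → q) ≡ length xs · q
∑-const []       q = refl
∑-const (x ∷ xs) q = cong (q ℚ.+_) (∑-const xs q)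

∑-nonNeg : ∀ (xs : List A) {g} → (∀ x → 0ℚ ℚ.≤ g x) → 0ℚ ℚ.≤ ∑ xs g
∑-nonNeg []       0≤g = ℚ.≤-refl
∑-nonNeg (x ∷ xs) 0≤g = ℚ.+-mono-≤ (0≤g x) (∑-nonNeg xs 0≤g)

∑-+ : ∀ (xs : List A) g h → ∑ xs (λ x → g x ℚ.+ h x) ≡ ∑ xs g ℚ.+ ∑ xs h
∑-+ []       g h = refl
∑-+ (x ∷ xs) g h =
  trans (cong (g x ℚ.+ h x ℚ.+_) (∑-+ xs g h)) (interchange (g x) (h x) (∑ xs g) (∑ xs h))

∑-*ˡ : ∀ (xs : List A) c g → ∑ xs (λ x → c ℚ.* g x) ≡ c ℚ.* ∑ xs g
∑-*ˡ []       c g = sym (ℚ.*-zeroʳ c)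
∑-*ˡ (x ∷ xs) c g =
  trans (cong (c ℚ.* g x ℚ.+_) (∑-*ˡ xs c g)) (sym (ℚ.*-distribˡ-+ c (g x) (∑ xs g)))

∑-*ʳ : ∀ (xs : List A) c g → ∑ xs (λ x → g x ℚ.* c) ≡ ∑ xs g ℚ.* c
∑-*ʳ xs c g = begin
  ∑ xs (λ x → g x ℚ.* c)  ≡⟨ ∑-cong xs (λ x → ℚ.*-comm (g x) c) ⟩
  ∑ xs (λ x → c ℚ.* g x)  ≡⟨ ∑-*ˡ xs c g ⟩
  c ℚ.* ∑ xs g            ≡⟨ ℚ.*-comm c (∑ xs g) ⟩
  ∑ xs g ℚ.* c            ∎
  where open ≡-Reasoning

∑-swap : ∀ (xs : List I) (ys : List J) (g : I → J → ℚ) →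
         ∑ xs (λ x → ∑ ys (g x)) ≡ ∑ ys (λ y → ∑ xs (λ x → g x y))
∑-swap []       ys g = sym (trans (∑-const ys 0ℚ) (k·0≡0 (length ys)))
  where
  k·0≡0 : ∀ k → k · 0ℚ ≡ 0ℚ
  k·0≡0 zero    = refl
  k·0≡0 (suc k) = trans (ℚ.+-identityˡ (k · 0ℚ)) (k·0≡0 k)
∑-swap (x ∷ xs) ys g = trans (cong (∑ ys (g x) ℚ.+_) (∑-swap xs ys g))
  (sym (∑-+ ys (g x) (λ y → ∑ xs (λ x → g x y))))

∑-map : ∀ (h : I → J) (xs : List I) g → ∑ (map h xs) g ≡ ∑ xs (g ∘ h)
∑-map h []       g = refl
∑-map h (x ∷ xs) g = cong (g (h x) ℚ.+_) (∑-map h xs g)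

𝟙 : Dec A → ℚ
𝟙 a? = if does a? then 1ℚ else 0ℚ

0≤𝟙 : (a? : Dec A) → 0ℚ ℚ.≤ 𝟙 a?
0≤𝟙 (yes _) = ℚ.nonNegative⁻¹ 1ℚ
0≤𝟙 (no _)  = ℚ.≤-refl

∑-filter : ∀ {P : A → Set} (P? : Decidable P) (xs : List A) g →
           ∑ xs (λ x → g x ℚ.* 𝟙 (P? x)) ≡ ∑ (filter P? xs) g
∑-filter P? []       g = refl
∑-filter P? (x ∷ xs) g with does (P? x)
... | true  = cong₂ ℚ._+_ (ℚ.*-identityʳ (g x)) (∑-filter P? xs g)
... | false = trans (cong₂ ℚ._+_ (ℚ.*-zeroʳ (g x)) (∑-filter P? xs g)) (ℚ.+-identityˡ _)

-- Double counting over ordered pairs of weighted blocks.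

module _ (xs : List I) (w : I → ℚ) (0≤w : ∀ x → 0ℚ ℚ.≤ w x) where

  -- Bounds W² by W (c + d), expanding W² over ordered pairs.
  ∑≤-of-pairwise : ∀ (G H : I → I → ℚ) {c d} →
                   (∀ x y → 1ℚ ℚ.≤ G x y ℚ.+ H y x) →
                   (∀ x → ∑ xs (λ y → w y ℚ.* G x y) ℚ.≤ c) →
                   (∀ x → ∑ xs (λ y → w y ℚ.* H x y) ℚ.≤ d) →
                   0ℚ ℚ.≤ c ℚ.+ d → ∑ xs w ℚ.≤ c ℚ.+ d
  ∑≤-of-pairwise G H {c} {d} 1≤G+H G≤c H≤d 0≤c+d with ℚ._≤?_ (∑ xs w) 0ℚ
  -- Cancelling `W` below requires it to be positive, so this case is settled by `0≤c+d`.
  ... | yes W≤0 = ℚ.≤-trans W≤0 0≤c+d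
  ... | no  W≰0 = ℚ.*-cancelˡ-≤-pos (∑ xs w) {{ℚ.positive (ℚ.≰⇒> W≰0)}} W*W≤W*[c+d]
    where
    W = ∑ xs w

    pair : ∀ x y → w x ℚ.* w y ℚ.≤ w x ℚ.* (w y ℚ.* G x y) ℚ.+ w y ℚ.* (w x ℚ.* H y x)
    pair x y = begin
      w x ℚ.* w y
        ≡⟨ ℚ.*-identityʳ (w x ℚ.* w y) ⟨
      w x ℚ.* w y ℚ.* 1ℚ
        ≤⟨ *-mono-≤-nonNegˡ (*-nonNeg (0≤w x) (0≤w y)) (1≤G+H x y) ⟩
      w x ℚ.* w y ℚ.* (G x y ℚ.+ H y x)
        ≡⟨ solve 4 (λ a b g h → a :* b :* (g :+ h) := a :* (b :* g) :+ b :* (a :* h)) refl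
             (w x) (w y) (G x y) (H y x) ⟩
      w x ℚ.* (w y ℚ.* G x y) ℚ.+ w y ℚ.* (w x ℚ.* H y x) ∎
      where open ℚ.≤-Reasoning

    weighted : ∀ (K : I → I → ℚ) {e} → (∀ x → ∑ xs (λ y → w y ℚ.* K x y) ℚ.≤ e) →
               ∑ xs (λ x → ∑ xs (λ y → w x ℚ.* (w y ℚ.* K x y))) ℚ.≤ W ℚ.* e
    weighted K {e} K≤e = begin
      ∑ xs (λ x → ∑ xs (λ y → w x ℚ.* (w y ℚ.* K x y)))
        ≡⟨ ∑-cong xs (λ x → ∑-*ˡ xs (w x) (λ y → w y ℚ.* K x y)) ⟩
      ∑ xs (λ x → w x ℚ.* ∑ xs (λ y → w y ℚ.* K x y))
        ≤⟨ ∑-mono-≤ xs (λ x → *-mono-≤-nonNegˡ (0≤w x) (K≤e x)) ⟩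
      ∑ xs (λ x → w x ℚ.* e)
        ≡⟨ ∑-*ʳ xs e w ⟩
      W ℚ.* e ∎
      where open ℚ.≤-Reasoning

    W*W≤W*[c+d] : W ℚ.* W ℚ.≤ W ℚ.* (c ℚ.+ d)
    W*W≤W*[c+d] = begin
      W ℚ.* W
        ≡⟨ ∑-*ʳ xs W w ⟨
      ∑ xs (λ x → w x ℚ.* W)
        ≡⟨ ∑-cong xs (λ x → ∑-*ˡ xs (w x) w) ⟨
      ∑ xs (λ x → ∑ xs (λ y → w x ℚ.* w y))
        ≤⟨ ∑-mono-≤ xs (λ x → ∑-mono-≤ xs (pair x)) ⟩
      ∑ xs (λ x → ∑ xs (λ y → g x y ℚ.+ h y x))
        ≡⟨ ∑-cong xs (λ x → ∑-+ xs (g x) (λ y → h y x)) ⟩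
      ∑ xs (λ x → ∑ xs (g x) ℚ.+ ∑ xs (λ y → h y x))
        ≡⟨ ∑-+ xs (λ x → ∑ xs (g x)) (λ x → ∑ xs (λ y → h y x)) ⟩
      ∑ xs (λ x → ∑ xs (g x)) ℚ.+ ∑ xs (λ x → ∑ xs (λ y → h y x))
        -- `H` is evaluated at the reversed pair; exchanging the sums gives its part the same shape
        -- as that of `G`, so `weighted` bounds both.
        ≡⟨ cong (∑ xs (λ x → ∑ xs (g x)) ℚ.+_) (∑-swap xs xs (λ x y → h y x)) ⟩
      ∑ xs (λ x → ∑ xs (g x)) ℚ.+ ∑ xs (λ y → ∑ xs (h y))
        ≤⟨ ℚ.+-mono-≤ (weighted G G≤c) (weighted H H≤d) ⟩
      W ℚ.* c ℚ.+ W ℚ.* d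
        ≡⟨ ℚ.*-distribˡ-+ W c d ⟨
      W ℚ.* (c ℚ.+ d) ∎
      where
      open ℚ.≤-Reasoning
      g h : I → I → ℚ
      g x y = w x ℚ.* (w y ℚ.* G x y)
      h x y = w x ℚ.* (w y ℚ.* H x y)

hits : List (Fin n) → Subset n → ℚ
hits is B = ∑ is (λ i → 𝟙 (i ∈? B))

0≤hits : ∀ (is : List (Fin n)) B → 0ℚ ℚ.≤ hits is B
0≤hits is B = ∑-nonNeg is (λ i → 0≤𝟙 (i ∈? B))

Any⇒1≤hits : ∀ {B : Subset n} {is} → Any (_∈ B) is → 1ℚ ℚ.≤ hits is B
Any⇒1≤hits {B = B} {i ∷ is} (here i∈B) with i ∈? B
... | yes _   = p≤p+q 1ℚ (0≤hits is B)
... | no  i∉B = contradiction i∈B i∉B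
Any⇒1≤hits {B = B} {i ∷ is} (there h) = ℚ.+-mono-≤ (0≤𝟙 (i ∈? B)) (Any⇒1≤hits h)

-- For any two blocks, one of them contains a probe of the other. Exempting
-- first from one of the two directions is what yields 2 k − 1 instead of 2 k.
record Probing (block : I → Subset n) (j : ℕ) : Set where
  field
    first       : I → Fin n
    rest        : I → List (Fin n)
    length-rest : ∀ c → length (rest c) ℕ.≤ j
    meets       : ∀ c d → Any (_∈ block d) (first c ∷ rest c) ⊎ Any (_∈ block c) (rest d)

module _ (xs : List I) (w : I → ℚ) (0≤w : ∀ x → 0ℚ ℚ.≤ w x) (block : I → Subset n) {l : ℚ}
         (0≤l : 0ℚ ℚ.≤ l)
         (load≤l : ∀ i → ∑ xs (λ x → w x ℚ.* 𝟙 (i ∈? block x)) ℚ.≤ l) where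

  -- Exchanging the sums turns the left side into the loads of the indices in `is`, each at most
  -- `l`.
  ∑hits≤length·load : ∀ is → ∑ xs (λ x → w x ℚ.* hits is (block x)) ℚ.≤ length is · l
  ∑hits≤length·load is = begin
    ∑ xs (λ x → w x ℚ.* hits is (block x))
      ≡⟨ ∑-cong xs (λ x → ∑-*ˡ is (w x) (λ i → 𝟙 (i ∈? block x))) ⟨
    ∑ xs (λ x → ∑ is (λ i → w x ℚ.* 𝟙 (i ∈? block x)))
      ≡⟨ ∑-swap xs is (λ x i → w x ℚ.* 𝟙 (i ∈? block x)) ⟩
    ∑ is (λ i → ∑ xs (λ x → w x ℚ.* 𝟙 (i ∈? block x)))
      ≤⟨ ∑-mono-≤ is load≤l ⟩
    ∑ is (λ _ → l)
      ≡⟨ ∑-const is l ⟩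
    length is · l ∎
    where open ℚ.≤-Reasoning

  -- `G` counts the hits of all probes of `c`, `H` only those of `rest c`. By `meets` one of the two
  -- counts is at least 1, and the probe lists have lengths at most `suc j` and `j`.
  probing⇒∑≤ : ∀ {j} → Probing block j → ∑ xs w ℚ.≤ (suc j ℕ.+ j) · l
  probing⇒∑≤ {j} P = subst (∑ xs w ℚ.≤_) (sym (×-homo-+ l (suc j) j))
    (∑≤-of-pairwise xs w 0≤w
      (λ c d → hits (first c ∷ rest c) (block d)) (λ c d → hits (rest c) (block d))
      (λ c d → [ (λ m → ℚ.≤-trans (Any⇒1≤hits m) (p≤p+q _ (0≤hits (rest d) (block c))))
               , (λ m → ℚ.+-mono-≤ (0≤hits (first c ∷ rest c) (block d)) (Any⇒1≤hits m)) ]′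
               (meets c d))
      (λ c → ℚ.≤-trans (∑hits≤length·load (first c ∷ rest c))
                       (·-monoˡ-≤ 0≤l (ℕ.s≤s (length-rest c))))
      (λ c → ℚ.≤-trans (∑hits≤length·load (rest c)) (·-monoˡ-≤ 0≤l (length-rest c)))
      (ℚ.+-mono-≤ (·-nonNeg (suc j) 0≤l) (·-nonNeg j 0≤l)))
    where open Probing P

-- Passing between real numbers and their rational approximations.

approx-≤ : ∀ x j k → approx x j ℚ.≤ approx x k ℚ.+ (½^ j ℚ.+ ½^ k)
approx-≤ x j k = ∣p-q∣≤r⇒p≤q+r (regular x j k)

-- `_+ℝ_` reads its summands one index deeper, so at each cons two copies of `½^ (suc k)` recombine
-- to `½^ k`, and only `e` accumulates. Closeness is assumed at every `k` because later summands are
-- read at ever larger indices.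
approx-sum : ∀ (q : A → ℚ) (a : A → ℝ) {e} →
             (∀ x k → ℚ.∣ q x ℚ.- approx (a x) k ∣ ℚ.≤ ½^ k ℚ.+ e) →
             ∀ xs k → ℚ.∣ ∑ xs q ℚ.- approx (sumℝ (map a xs)) k ∣ ℚ.≤ ½^ k ℚ.+ length xs · e
approx-sum q a close []       k = subst (0ℚ ℚ.≤_) (sym (ℚ.+-identityʳ (½^ k))) (0≤½^ k)
approx-sum q a {e} close (x ∷ xs) k = begin
  ℚ.∣ (q x ℚ.+ s) ℚ.- (r ℚ.+ t) ∣
    ≡⟨ cong ℚ.∣_∣ (solve 4 (λ q s r t → q :+ s :- (r :+ t) := (q :- r) :+ (s :- t)) refl
                     (q x) s r t) ⟩
  ℚ.∣ (q x ℚ.- r) ℚ.+ (s ℚ.- t) ∣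
    ≤⟨ ℚ.∣p+q∣≤∣p∣+∣q∣ (q x ℚ.- r) (s ℚ.- t) ⟩
  ℚ.∣ q x ℚ.- r ∣ ℚ.+ ℚ.∣ s ℚ.- t ∣
    ≤⟨ ℚ.+-mono-≤ (close x (suc k)) (approx-sum q a close xs (suc k)) ⟩
  (½^ (suc k) ℚ.+ e) ℚ.+ (½^ (suc k) ℚ.+ length xs · e)
    ≡⟨ interchange (½^ (suc k)) e (½^ (suc k)) (length xs · e) ⟩
  (½^ (suc k) ℚ.+ ½^ (suc k)) ℚ.+ (e ℚ.+ length xs · e)
    ≡⟨ cong (ℚ._+ (suc (length xs) · e)) (½^suc+½^suc≡½^ k) ⟩
  ½^ k ℚ.+ suc (length xs) · e ∎
  where
  open ℚ.≤-Reasoning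
  s = ∑ xs q
  r = approx (a x) (suc k)
  t = approx (sumℝ (map a xs)) (suc k)

-- The choice `m = c + j` shrinks the last term to `½^ j`, which fills the slack of two copies of
-- `½^ j` that `_≤ℝ_` grants at index `j`.
≤ℝ-of-approx : ∀ x q c → (∀ j m → approx x j ℚ.≤ q ℚ.+ (½^ j ℚ.+ suc c · ½^ m)) → x ≤ℝ fromℚ q
≤ℝ-of-approx x q c h j = ℚ.≤-trans (h j (c ℕ.+ j))
  (ℚ.+-monoʳ-≤ q (ℚ.+-monoʳ-≤ (½^ j) (suc·½^≤½^ c j)))

-- Flipped bits and partial assignments.

flipped⇒∈ : ∀ (x : Input n) B i → lookup (flipBlock x B) i ≢ lookup x i → i ∈ B
flipped⇒∈ x B i ≢xᵢ = Vec.lookup⇒[]= i B (Bool.¬-not Bᵢ≢false)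
  where
  Bᵢ≢false : lookup B i ≢ false
  Bᵢ≢false Bᵢ≡false = ≢xᵢ (begin
    lookup (flipBlock x B) i    ≡⟨ Vec.lookup-zipWith _xor_ i x B ⟩
    lookup x i xor lookup B i   ≡⟨ cong (lookup x i xor_) Bᵢ≡false ⟩
    lookup x i xor false        ≡⟨ Bool.xor-identityʳ (lookup x i) ⟩
    lookup x i                  ∎)
    where open ≡-Reasoning

support : Partial n → List (Fin n)
support []            = []
support (just _  ∷ p) = zero ∷ map suc (support p)
support (nothing ∷ p) = map suc (support p)

length-support : ∀ (p : Partial n) → length (support p) ≡ size p
length-support []            = refl
length-support (just _  ∷ p) = cong suc (trans (List.length-map suc (support p)) (length-support p))
length-support (nothing ∷ p) = trans (List.length-map suc (support p)) (length-support p)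

∈-support⁺ : ∀ (p : Partial n) i {b} → lookup p i ≡ just b → i List.∈ support p
∈-support⁺ (just _  ∷ p) zero    eq = here refl
∈-support⁺ (just _  ∷ p) (suc i) eq = there (∈-map⁺ suc (∈-support⁺ p i eq))
∈-support⁺ (nothing ∷ p) (suc i) eq = ∈-map⁺ suc (∈-support⁺ p i eq)

∈-support⁻ : ∀ (p : Partial n) {i} → i List.∈ support p → ∃ λ b → lookup p i ≡ just b
∈-support⁻ (just b  ∷ p) (here refl) = b , refl
∈-support⁻ (just _  ∷ p) (there i∈)  with ∈-map⁻ suc i∈
... | j , j∈ , refl = ∈-support⁻ p j∈
∈-support⁻ (nothing ∷ p) i∈          with ∈-map⁻ suc i∈
... | j , j∈ , refl = ∈-support⁻ p j∈

Agrees : Partial n → Input n → Pred (Fin n) _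
Agrees p x i = lookup p i ≡ just (lookup x i)

agrees? : ∀ (p : Partial n) x → Decidable (Agrees p x)
agrees? p x i = Maybe.≡-dec Bool._≟_ (lookup p i) (just (lookup x i))

-- Containment constrains only the finite list `support p`, where agreement is decidable, so its
-- failure yields an explicit index.
⋢⇒disagreement : ∀ (p : Partial n) x → ¬ p ⊑ x →
                 ∃₂ λ i b → lookup p i ≡ just b × b ≢ lookup x i
⋢⇒disagreement p x p⋢x with All.all? (agrees? p x) (support p)
... | yes all = contradiction
  (λ i b pᵢ≡b → Maybe.just-injective (trans (sym (All.lookup all (∈-support⁺ p i pᵢ≡b))) pᵢ≡b))
  p⋢x
... | no ¬all =
  let i , i∈ , ¬agrees = List.find (¬All⇒Any¬ (agrees? p x) (support p) ¬all)
      b , pᵢ≡b         = ∈-support⁻ p i∈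
  in i , b , pᵢ≡b , λ b≡xᵢ → ¬agrees (trans pᵢ≡b (cong just b≡xᵢ))

-- At `i` the flipped input carries the bit `b` prescribed by `p`, which is not the bit of `x`, so
-- the flip changed it.
disagreement⇒∈ : ∀ (p : Partial n) x B {i b} → p ⊑ flipBlock x B →
                 lookup p i ≡ just b → b ≢ lookup x i → i ∈ B
disagreement⇒∈ p x B {i} {b} p⊑xᴮ pᵢ≡b b≢xᵢ =
  flipped⇒∈ x B i (subst (_≢ lookup x i) (sym (p⊑xᴮ i b pᵢ≡b)) b≢xᵢ)

-- Probes obtained from an unambiguous collection.

module _ (f : BoolFun n) (x : Input n) where

  -- Indices carry a sensitivity proof, so that probes and certificates are total functions of the
  -- index.
  block : ∃ (Sensitive f x) → Subset n
  block = proj₁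

  -- One list that hits every block can serve as the probes of all of them. A direct count would
  -- give `suc j` loads instead of `suc j + j`; this form puts both values of `f x` under one bound.
  constant-probing : ∀ (is : List (Fin n)) j → length is ℕ.≤ suc j →
                     (∀ c → Any (_∈ block c) is) → Probing block j
  -- An empty list hits nothing, so there is no sensitive block and the fields hold vacuously.
  constant-probing []       j _         hit = record
    { first       = λ c → contradiction (hit c) λ ()
    ; rest        = λ _ → []
    ; length-rest = λ _ → ℕ.z≤n
    ; meets       = λ c _ → contradiction (hit c) λ ()
    }
  constant-probing (i ∷ is) j (ℕ.s≤s ≤j) hit = record
    { first       = λ _ → i
    ; rest        = λ _ → is
    ; length-rest = λ _ → ≤j
    ; meets       = λ _ d → inj₁ (hit d)
    }

  module _ {b : Bool} {U : List (Partial n)} (unamb : IsUnambiguousCollection f b U) {j : ℕ}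
           (size≤ : ∀ p → p List.∈ U → size p ℕ.≤ suc j) where
    open IsUnambiguousCollection unamb

    probing-inside : f x ≡ b → Probing block j
    probing-inside fx≡b with covers x fx≡b
    ... | p , p∈U , p⊑x = constant-probing (support p) j
      (subst (ℕ._≤ suc j) (sym (length-support p)) (size≤ p p∈U)) hit
      where
      hit : ∀ c → Any (_∈ block c) (support p)
      hit (B , sens) =
        -- If the flipped input extended `p`, its value would be `b`, against sensitivity. At the
        -- resulting disagreement `x` still agrees with `p`, so that bit was flipped.
        let i , b′ , pᵢ≡b′ , b′≢ = ⋢⇒disagreement p (flipBlock x B)
              λ p⊑xᴮ → sens (trans (certificates p p∈U _ p⊑xᴮ) (sym fx≡b))
        in List.lose (∈-support⁺ p i pᵢ≡b′)
             (flipped⇒∈ x B i λ eq → b′≢ (trans (sym (p⊑x i b′ pᵢ≡b′)) (sym eq)))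

    module _ (fx≢b : f x ≢ b) where

      certificate : ∀ c → ∃ λ p → p List.∈ U × p ⊑ flipBlock x (block c)
      certificate (B , sens) = covers (flipBlock x B)
        -- The value at the flipped input and `b` both differ from `f x`, hence coincide.
        (trans (Bool.¬-not sens) (sym (Bool.¬-not (fx≢b ∘ sym))))

      cert : ∃ (Sensitive f x) → Partial n
      cert c = proj₁ (certificate c)

      cert∈U : ∀ c → cert c List.∈ U
      cert∈U c = proj₁ (proj₂ (certificate c))

      cert⊑flip : ∀ c → cert c ⊑ flipBlock x (block c)
      cert⊑flip c = proj₂ (proj₂ (certificate c))

      disagreement : ∀ c → ∃₂ λ i b′ → lookup (cert c) i ≡ just b′ × b′ ≢ lookup x i
      disagreement c = ⋢⇒disagreement (cert c) x (fx≢b ∘ certificates (cert c) (cert∈U c) x)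

      agreeing : ∃ (Sensitive f x) → List (Fin n)
      agreeing c = filter (agrees? (cert c) x) (support (cert c))

      -- `disagreement` supplies an entry of the support that the filter drops; this strictness
      -- gives `j` instead of `suc j`.
      length-agreeing : ∀ c → length (agreeing c) ℕ.≤ j
      length-agreeing c = ℕ.s≤s⁻¹ (begin-strict
        length (agreeing c)
          <⟨ List.filter-notAll (agrees? (cert c) x) (support (cert c)) any¬ ⟩
        length (support (cert c))
          ≡⟨ length-support (cert c) ⟩
        size (cert c)
          ≤⟨ size≤ (cert c) (cert∈U c) ⟩
        suc j ∎)
        where
        open ℕ.≤-Reasoning
        any¬ : Any (¬_ ∘ Agrees (cert c) x) (support (cert c))
        any¬ = let i , b′ , pᵢ≡b′ , b′≢xᵢ = disagreement c in
          List.lose (∈-support⁺ (cert c) i pᵢ≡b′)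
            λ agrees → b′≢xᵢ (Maybe.just-injective (trans (sym pᵢ≡b′) agrees))

      first-disagreement : ∃ (Sensitive f x) → Fin n
      first-disagreement c = proj₁ (disagreement c)

      ∈-agreeing : ∀ c {i b′} → lookup (cert c) i ≡ just b′ → b′ ≡ lookup x i →
                   i List.∈ agreeing c
      ∈-agreeing c {i} pᵢ≡b′ b′≡xᵢ = ∈-filter⁺ (agrees? (cert c) x)
        (∈-support⁺ (cert c) i pᵢ≡b′) (trans pᵢ≡b′ (cong just b′≡xᵢ))

      -- If both alternatives fail, the certificates are consistent: two bits that both equal or
      -- both differ from that of `x` are equal, and an index where just one certificate agrees with
      -- `x` lies in its `agreeing` list and in the other block.
      agreeing-meets : ∀ c d → cert c ≢ cert d →
                       Any (_∈ block d) (agreeing c) ⊎ Any (_∈ block c) (agreeing d)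
      agreeing-meets c d p≢q
        with Any.any? (_∈? block d) (agreeing c) | Any.any? (_∈? block c) (agreeing d)
      ... | yes m | _     = inj₁ m
      ... | no _  | yes m = inj₂ m
      ... | no ¬m | no ¬m′ =
        contradiction consistent (unambiguous (cert c) (cert d) (cert∈U c) (cert∈U d) p≢q)
        where
        consistent : Consistent (cert c) (cert d)
        consistent i b₁ b₂ pᵢ≡b₁ qᵢ≡b₂ with b₁ Bool.≟ lookup x i | b₂ Bool.≟ lookup x i
        ... | yes b₁≡xᵢ | yes b₂≡xᵢ = trans b₁≡xᵢ (sym b₂≡xᵢ)
        ... | no  b₁≢xᵢ | no  b₂≢xᵢ = trans (Bool.¬-not b₁≢xᵢ) (sym (Bool.¬-not b₂≢xᵢ))
        ... | yes b₁≡xᵢ | no  b₂≢xᵢ = contradiction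
          (List.lose (∈-agreeing c pᵢ≡b₁ b₁≡xᵢ)
            (disagreement⇒∈ (cert d) x (block d) (cert⊑flip d) qᵢ≡b₂ b₂≢xᵢ)) ¬m
        ... | no  b₁≢xᵢ | yes b₂≡xᵢ = contradiction
          (List.lose (∈-agreeing d qᵢ≡b₂ b₂≡xᵢ)
            (disagreement⇒∈ (cert c) x (block c) (cert⊑flip c) pᵢ≡b₁ b₁≢xᵢ)) ¬m′

      probing-outside : Probing block j
      probing-outside = record
        { first       = first-disagreement
        ; rest        = agreeing
        ; length-rest = length-agreeing
        ; meets       = meets
        }
        where
        meets : ∀ c d → Any (_∈ block d) (first-disagreement c ∷ agreeing c) ⊎
                        Any (_∈ block c) (agreeing d)
        meets c d with Vec.≡-dec (Maybe.≡-dec Bool._≟_) (cert c) (cert d)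
        ... | no  p≢q = Sum.map₁ there (agreeing-meets c d p≢q)
        -- The disagreement found for `c` is one of the shared certificate, so it also lies in
        -- `block d`.
        ... | yes p≡q =
          let i , b′ , pᵢ≡b′ , b′≢xᵢ = disagreement c
          in inj₁ (here (disagreement⇒∈ (cert d) x (block d) (cert⊑flip d)
               (subst (λ p → lookup p i ≡ just b′) p≡q pᵢ≡b′) b′≢xᵢ))

    probing : Probing block j
    probing with f x Bool.≟ b
    ... | yes fx≡b = probing-inside fx≡b
    ... | no  fx≢b = probing-outside fx≢b

-- From rational weights to real packings.

toList-proj₁ : ∀ {P : A → Set} {xs} (pxs : All P xs) → map proj₁ (All.toList pxs) ≡ xs
toList-proj₁ []         = refl
toList-proj₁ {xs = x ∷ _} (px ∷ pxs) = cong (x ∷_) (toList-proj₁ pxs)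

module _ (f : BoolFun n) (x : Input n) {a : Subset n → ℝ} (packing : IsFractionalPacking f x a)
         {j : ℕ} (probe : Probing (block f x) j) where
  open IsFractionalPacking packing

  private
    N : ℕ
    N = length (sensitiveBlocks f x)

    -- Each listed block is paired with its sensitivity proof, to match the index type of `Probing`.
    sensitives : List (∃ (Sensitive f x))
    sensitives = All.toList (all-filter (sensitive? f x) (allSubsets n))

    ∑-sensitives : ∀ g → ∑ sensitives (g ∘ block f x) ≡ ∑ (sensitiveBlocks f x) g
    ∑-sensitives g = trans (sym (∑-map proj₁ sensitives g))
      (cong (λ Bs → ∑ Bs g) (toList-proj₁ (all-filter (sensitive? f x) (allSubsets n))))

    -- Shifting the approximation up makes it nonnegative at sensitive blocks.
    rounded : ℕ → Subset n → ℚ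
    rounded m B = approx (a B) (2 ℕ.+ m) ℚ.+ ½^ (1 ℕ.+ m)

    0≤rounded : ∀ m c → 0ℚ ℚ.≤ rounded m (block f x c)
    -- At index `2 + m` nonnegativity of a real permits a deficit of two copies of `½^ (2 + m)`,
    -- exactly the shift `½^ (1 + m)`.
    0≤rounded m (B , sens) = subst (λ e → 0ℚ ℚ.≤ approx (a B) (2 ℕ.+ m) ℚ.+ e)
      (½^suc+½^suc≡½^ (1 ℕ.+ m)) (nonNegative B sens (2 ℕ.+ m))

    rounded-close : ∀ m B k → ℚ.∣ rounded m B ℚ.- approx (a B) k ∣ ℚ.≤ ½^ k ℚ.+ ½^ m
    rounded-close m B k = begin
      ℚ.∣ r ℚ.+ e ℚ.- s ∣
        ≡⟨ cong ℚ.∣_∣ (solve 3 (λ r e s → r :+ e :- s := r :- s :+ e) refl r e s) ⟩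
      ℚ.∣ r ℚ.- s ℚ.+ e ∣
        ≤⟨ ℚ.∣p+q∣≤∣p∣+∣q∣ (r ℚ.- s) e ⟩
      ℚ.∣ r ℚ.- s ∣ ℚ.+ ℚ.∣ e ∣
        ≡⟨ cong (ℚ.∣ r ℚ.- s ∣ ℚ.+_) (ℚ.0≤p⇒∣p∣≡p (0≤½^ (1 ℕ.+ m))) ⟩
      ℚ.∣ r ℚ.- s ∣ ℚ.+ e
        ≤⟨ ℚ.+-monoˡ-≤ e (regular (a B) (2 ℕ.+ m) k) ⟩
      ½^ (2 ℕ.+ m) ℚ.+ ½^ k ℚ.+ e
        ≤⟨ ℚ.+-monoˡ-≤ e (ℚ.+-monoˡ-≤ (½^ k) (½^suc≤½^ (1 ℕ.+ m))) ⟩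
      e ℚ.+ ½^ k ℚ.+ e
        ≡⟨ solve 2 (λ e k → e :+ k :+ e := k :+ (e :+ e)) refl e (½^ k) ⟩
      ½^ k ℚ.+ (e ℚ.+ e)
        ≡⟨ cong (½^ k ℚ.+_) (½^suc+½^suc≡½^ m) ⟩
      ½^ k ℚ.+ ½^ m ∎
      where
      open ℚ.≤-Reasoning
      r = approx (a B) (2 ℕ.+ m)
      s = approx (a B) k
      e = ½^ (1 ℕ.+ m)

    -- Of the `3 + N` units, at most `N` come from rounding the blocks in a load, one from reading
    -- the real sum at index `m`, and two from the slack in `load≤1`.
    error : ℕ → ℚ
    error m = (3 ℕ.+ N) · ½^ m

    0≤error : ∀ m → 0ℚ ℚ.≤ error m
    0≤error m = ·-nonNeg (3 ℕ.+ N) (0≤½^ m)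

    load≤1+error : ∀ m i →
                   ∑ sensitives (λ c → rounded m (block f x c) ℚ.* 𝟙 (i ∈? block f x c))
                     ℚ.≤ 1ℚ ℚ.+ error m
    load≤1+error m i = begin
      ∑ sensitives (λ c → rounded m (block f x c) ℚ.* 𝟙 (i ∈? block f x c))
        ≡⟨ ∑-sensitives (λ B → rounded m B ℚ.* 𝟙 (i ∈? B)) ⟩
      ∑ (sensitiveBlocks f x) (λ B → rounded m B ℚ.* 𝟙 (i ∈? B))
        ≡⟨ ∑-filter (i ∈?_) (sensitiveBlocks f x) (rounded m) ⟩
      ∑ Bs (rounded m)
        ≤⟨ ∣p-q∣≤r⇒p≤q+r (approx-sum (rounded m) a (rounded-close m) Bs m) ⟩
      approx (sumℝ (map a Bs)) m ℚ.+ (½^ m ℚ.+ length Bs · ½^ m)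
        ≤⟨ ℚ.+-mono-≤ (load≤1 i m) (ℚ.+-monoʳ-≤ (½^ m)
             (·-monoˡ-≤ (0≤½^ m) (List.length-filter (i ∈?_) (sensitiveBlocks f x)))) ⟩
      1ℚ ℚ.+ (½^ m ℚ.+ ½^ m) ℚ.+ (½^ m ℚ.+ N · ½^ m)
        ≡⟨ solve 3 (λ o e s → o :+ (e :+ e) :+ (e :+ s) := o :+ (e :+ (e :+ (e :+ s)))) refl
             1ℚ (½^ m) (N · ½^ m) ⟩
      1ℚ ℚ.+ error m ∎
      where
      open ℚ.≤-Reasoning
      Bs = filter (i ∈?_) (sensitiveBlocks f x)

    M : ℕ
    M = suc j ℕ.+ j

  -- The enlarged load bound contributes `M` copies of `error m`; the remaining copy absorbs the
  -- rounding `(1 + N) · ½^ m` of the total weight.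
  approx-totalWeight≤ : ∀ m → approx (totalWeight f x a) m ℚ.≤ M · 1ℚ ℚ.+ suc M · error m
  approx-totalWeight≤ m = begin
    approx (totalWeight f x a) m
      ≤⟨ ∣p-q∣≤r⇒p≤q+r (subst (ℚ._≤ (½^ m ℚ.+ N · ½^ m))
           (∣p-q∣≡∣q-p∣ (∑ (sensitiveBlocks f x) (rounded m)) (approx (totalWeight f x a) m))
           (approx-sum (rounded m) a (rounded-close m) (sensitiveBlocks f x) m)) ⟩
    ∑ (sensitiveBlocks f x) (rounded m) ℚ.+ (1 ℕ.+ N) · ½^ m
      ≡⟨ cong (ℚ._+ (1 ℕ.+ N) · ½^ m) (∑-sensitives (rounded m)) ⟨
    ∑ sensitives (rounded m ∘ block f x) ℚ.+ (1 ℕ.+ N) · ½^ m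
      ≤⟨ ℚ.+-mono-≤
           (probing⇒∑≤ sensitives (rounded m ∘ block f x) (0≤rounded m) (block f x)
             (ℚ.+-mono-≤ (ℚ.nonNegative⁻¹ 1ℚ) (0≤error m)) (load≤1+error m) probe)
           (·-monoˡ-≤ (0≤½^ m) (ℕ.m≤n+m (1 ℕ.+ N) 2)) ⟩
    M · (1ℚ ℚ.+ error m) ℚ.+ error m
      ≡⟨ cong (ℚ._+ error m) (×-distrib-+ 1ℚ (error m) M) ⟩
    M · 1ℚ ℚ.+ M · error m ℚ.+ error m
      ≡⟨ solve 3 (λ o s e → o :+ s :+ e := o :+ (e :+ s)) refl (M · 1ℚ) (M · error m) (error m) ⟩
    M · 1ℚ ℚ.+ suc M · error m ∎
    where open ℚ.≤-Reasoning

  ≤totalWeight⇒≤ : ∀ r → r ≤ℝ totalWeight f x a → r ≤ℝ fromℚ (M · 1ℚ)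
  -- Besides `suc M` errors of `3 + N` units each, `r≤W` costs two copies of `½^ m` and moving `r`
  -- from index `i` to `m` costs one. The constant is 2 rather than 3 because `≤ℝ-of-approx` counts
  -- `suc c` units.
  ≤totalWeight⇒≤ r r≤W = ≤ℝ-of-approx r (M · 1ℚ) (2 ℕ.+ suc M ℕ.* (3 ℕ.+ N)) λ i m → begin
    approx r i
      ≤⟨ approx-≤ r i m ⟩
    approx r m ℚ.+ (½^ i ℚ.+ ½^ m)
      ≤⟨ ℚ.+-monoˡ-≤ (½^ i ℚ.+ ½^ m) (r≤W m) ⟩
    approx (totalWeight f x a) m ℚ.+ (½^ m ℚ.+ ½^ m) ℚ.+ (½^ i ℚ.+ ½^ m)
      ≤⟨ ℚ.+-monoˡ-≤ (½^ i ℚ.+ ½^ m) (ℚ.+-monoˡ-≤ (½^ m ℚ.+ ½^ m) (approx-totalWeight≤ m)) ⟩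
    M · 1ℚ ℚ.+ suc M · error m ℚ.+ (½^ m ℚ.+ ½^ m) ℚ.+ (½^ i ℚ.+ ½^ m)
      ≡⟨ cong (λ s → M · 1ℚ ℚ.+ s ℚ.+ (½^ m ℚ.+ ½^ m) ℚ.+ (½^ i ℚ.+ ½^ m))
           (×-assocˡ (½^ m) (suc M) (3 ℕ.+ N)) ⟩
    M · 1ℚ ℚ.+ (suc M ℕ.* (3 ℕ.+ N)) · ½^ m ℚ.+ (½^ m ℚ.+ ½^ m) ℚ.+ (½^ i ℚ.+ ½^ m)
      ≡⟨ solve 4 (λ o s e h → o :+ s :+ (e :+ e) :+ (h :+ e) := o :+ (h :+ (e :+ (e :+ (e :+ s)))))
           refl (M · 1ℚ) ((suc M ℕ.* (3 ℕ.+ N)) · ½^ m) (½^ m) (½^ i) ⟩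
    M · 1ℚ ℚ.+ (½^ i ℚ.+ (3 ℕ.+ suc M ℕ.* (3 ℕ.+ N)) · ½^ m) ∎
    where open ℚ.≤-Reasoning

-- Widths of collections and the final bound.

module _ {f : BoolFun n} where

  UCmin-attained : ∀ {k} → IsUCmin f k →
                   ∃₂ λ b U → IsUnambiguousCollection f b U × k ≡ width U
  UCmin-attained (k₀ , k₁ , ((U₀ , unamb₀ , eq₀) , _) , ((U₁ , unamb₁ , eq₁) , _) , k≡k₀⊓k₁)
    with ℕ.⊓-sel k₀ k₁
  ... | inj₁ ≡k₀ = false , U₀ , unamb₀ , trans k≡k₀⊓k₁ (trans ≡k₀ eq₀)
  ... | inj₂ ≡k₁ = true  , U₁ , unamb₁ , trans k≡k₀⊓k₁ (trans ≡k₁ eq₁)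

  attains : NonConstant f → ∀ b → ∃ λ x → f x ≡ b
  attains (x , y , fx≢fy) b with f x Bool.≟ b
  ... | yes fx≡b = x , fx≡b
  ... | no  fx≢b = y , trans (Bool.¬-not (fx≢fy ∘ sym)) (sym (Bool.¬-not (fx≢b ∘ sym)))

  -- A certificate without entries is contained in every input and would force equal values at `x`
  -- and `y`.
  nonConstant⇒certificate≢∅ : NonConstant f → ∀ {b} p → IsCertificate f b p → size p ≢ 0
  nonConstant⇒certificate≢∅ (x , y , fx≢fy) p cert size≡0 =
    fx≢fy (trans (cert x (p⊑ x)) (sym (cert y (p⊑ y))))
    where
    p⊑ : ∀ z → p ⊑ z
    p⊑ z i c pᵢ≡c with support p | trans (length-support p) size≡0 | ∈-support⁺ p i pᵢ≡c
    ... | [] | _ | ()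

size≤width : ∀ {U : List (Partial n)} p → p List.∈ U → size p ℕ.≤ width U
size≤width {U = U} p p∈U = All.lookup (xs≤max 0 (map size U)) (∈-map⁺ size p∈U)

[2j+1]·1≡2[j+1]-1 : ∀ j → (suc j ℕ.+ j) · 1ℚ ≡ (+ 2 * + suc j - 1ℤ) ℚ./ 1
[2j+1]·1≡2[j+1]-1 j = trans (n·1≡n/1 (suc j ℕ.+ j)) (cong (ℚ._/ 1) 2j+1≡)
  where
  2j+1≡ : + (suc j ℕ.+ j) ≡ + 2 * + suc j - 1ℤ
  -- The integer on the right computes to `+ (j + suc (j + 0))`.
  2j+1≡ = cong +_ (trans (sym (ℕ.+-suc j j)) (cong (λ i → j ℕ.+ suc i) (sym (ℕ.+-identityʳ j))))

RC≤2·width-1 : ∀ (f : BoolFun n) → NonConstant f →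
               ∀ r {b U} k → IsRC f r → IsUnambiguousCollection f b U → k ≡ width U →
               r ≤ℝ fromℤ (+ 2 * + k - 1ℤ)
-- Width zero cannot occur: `b` is attained, so the collection has a member, and that member would
-- have no entries.
RC≤2·width-1 f nonconst _ {b} zero _ unamb 0≡width =
  let open IsUnambiguousCollection unamb
      x , fx≡b    = attains nonconst b
      p , p∈U , _ = covers x fx≡b
  in contradiction
       (ℕ.n≤0⇒n≡0 (subst (size p ℕ.≤_) (sym 0≡width) (size≤width p p∈U)))
       (nonConstant⇒certificate≢∅ nonconst p (certificates p p∈U))
-- The maxima defining `r` are attained, so it suffices to bound the one packing `a` at the one
-- input `x`.
RC≤2·width-1 f nonconst r (suc j) ((x , (a , packing , r≤W , _) , _) , _) unamb k≡width =
  subst (λ q → r ≤ℝ fromℚ q) ([2j+1]·1≡2[j+1]-1 j)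
    (≤totalWeight⇒≤ f x packing
      (probing f x unamb λ p p∈U → subst (size p ℕ.≤_) (sym k≡width) (size≤width p p∈U))
      r r≤W)

theorem9 : ∀ (n : ℕ) (f : BoolFun n) → NonConstant f →
    ∀ (rc : ℝ) (ucmin : ℕ) → IsRC f rc → IsUCmin f ucmin →
    rc ≤ℝ fromℤ (+ 2 * + ucmin - 1ℤ)
theorem9 n f nonconst rc ucmin isRC isUCmin =
  let b , U , unamb , ucmin≡width = UCmin-attained isUCmin
  in RC≤2·width-1 f nonconst rc ucmin isRC unamb ucmin≡width
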